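{- For every $k\geq1$ there is a bipartite graph $G$ such that $\mathrm{stw}(G)\leq\mathrm{tw}(G)+1\leq k+1\leq \mathrm{ca}_f(G)=i(G)$.
   Context: All graphs are finite and simple. A $k$-tree is obtained from a $(k+1)$-clique by repeatedly adding a new vertex adjacent exactly to some $k$-clique of the current graph; $\mathrm{tw}(G)$ is the minimum $k$ such that $G$ is a subgraph of a $k$-tree. A simple $k$-tree is a $k$-tree with such a construction sequence in which no two vertices are added onto the same $k$-clique; $\mathrm{stw}(G)$ is the minimum $k$ such that $G$ is a subgraph of a simple $k$-tree. For a graph class $\mathcal{T}$ closed under disjoint union, the folded covering number $c_f^{\mathcal T}(G)$ is the minimum, over all edge-surjective graph homomorphisms $\varphi:T\to G$ with $T\in\mathcal{T}$, of $\max_{v\in V(G)}|\varphi^{ -1}(v)|$ (equivalently: the least $k$ such that each vertex can be split into at most $k$ vertices, distributing its incident edges among them, possibly repeatedly, so that the result lies in $\mathcal{T}$). A caterpillar is a tree whose non-leaf vertices form a path; $\mathrm{ca}_f(G)=c_f^{\mathcal{Ca}}(G)$ with $\mathcal{Ca}$ the class of caterpillar forests, and the interval-number is $i(G)=c_f^{\mathcal I}(G)$ with $\mathcal I$ the class of interval graphs (intersection graphs of finite families of real intervals). -}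

module Defs where

open import Data.Nat using (ℕ; zero; suc; _≤_)
open import Data.Bool using (Bool; true; false; not; if_then_else_)
open import Data.Fin using (Fin; zero; suc; _≟_)
open import Data.Fin.Subset using (Subset; _∈_; ∣_∣)
open import Data.Vec using (_∷_; lookup)
open import Data.List using (List; []; _∷_; _++_; [_]; map; allFin; length)
open import Data.Nat.ListAction using (sum)
open import Data.List.Relation.Unary.Linked using (Linked)
open import Data.List.Relation.Unary.Unique.Propositional using (Unique)
open import Data.List.Membership.Propositional using () renaming (_∈_ to _∈L_)
open import Data.Product using (Σ; _×_; _,_)
open import Data.Empty using (⊥; ⊥-elim)
open import Relation.Nullary using (¬_; does; yes; no)
open import Relation.Binary.PropositionalEquality using (_≡_; _≢_; refl; sym)
open import Function.Bundles using (_⇔_)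
open import Data.Rational using (ℚ) renaming (_≤_ to _≤ℚ_)

record Graph (n : ℕ) : Set where
  field
    adj        : Fin n → Fin n → Bool
    adj-sym    : ∀ u v → adj u v ≡ adj v u
    adj-irrefl : ∀ u → adj u u ≡ false

Edge : ∀ {n} → Graph n → Fin n → Fin n → Set
Edge G u v = Graph.adj G u v ≡ true

ind : Bool → ℕ
ind b = if b then 1 else 0

degree : ∀ {n} → Graph n → Fin n → ℕ
degree {n} G v = sum (map (λ u → ind (Graph.adj G v u)) (allFin n))

_⊆G_ : ∀ {n m} → Graph n → Graph m → Set
_⊆G_ {n} {m} G H =
  Σ (Fin n → Fin m) λ f →
    (∀ u v → f u ≡ f v → u ≡ v) × (∀ u v → Edge G u v → Edge H (f u) (f v))

Bipartite : ∀ {n} → Graph n → Set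
Bipartite {n} G = Σ (Fin n → Bool) λ c → ∀ u v → Edge G u v → c u ≢ c v

IsMin : (ℕ → Set) → ℕ → Set
IsMin P m = P m × (∀ m' → P m' → m ≤ m')

complete : (n : ℕ) → Graph n
complete n = record { adj = λ u v → not (does (u ≟ v)) ; adj-sym = s ; adj-irrefl = i }
  where
  s : ∀ (u v : Fin n) → not (does (u ≟ v)) ≡ not (does (v ≟ u))
  s u v with u ≟ v | v ≟ u
  ... | yes _ | yes _ = refl
  ... | no _  | no _  = refl
  ... | yes p | no q  = ⊥-elim (q (sym p))
  ... | no p  | yes q = ⊥-elim (p (sym q))
  i : ∀ (u : Fin n) → not (does (u ≟ u)) ≡ false
  i u with u ≟ u
  ... | yes _ = refl
  ... | no p  = ⊥-elim (p refl)

extend : ∀ {n} → Graph n → Subset n → Graph (suc n)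
extend {n} G S = record { adj = a ; adj-sym = s ; adj-irrefl = i }
  where
  a : Fin (suc n) → Fin (suc n) → Bool
  a zero    zero    = false
  a zero    (suc v) = lookup S v
  a (suc u) zero    = lookup S u
  a (suc u) (suc v) = Graph.adj G u v
  s : ∀ u v → a u v ≡ a v u
  s zero    zero    = refl
  s zero    (suc v) = refl
  s (suc u) zero    = refl
  s (suc u) (suc v) = Graph.adj-sym G u v
  i : ∀ u → a u u ≡ false
  i zero    = refl
  i (suc u) = Graph.adj-irrefl G u

IsClique : ∀ {n} → Graph n → Subset n → Set
IsClique G S = ∀ u v → u ≢ v → u ∈ S → v ∈ S → Edge G u v

-- A construction sequence of a k-tree G; the list records the k-cliques
-- onto which the vertices were added (in the vertex numbering of G).
data KTreeSeq (k : ℕ) : (n : ℕ) → Graph n → List (Subset n) → Set where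
  base : KTreeSeq k (suc k) (complete (suc k)) []
  add  : ∀ {n G L} → KTreeSeq k n G L →
         (S : Subset n) → IsClique G S → ∣ S ∣ ≡ k →
         KTreeSeq k (suc n) (extend G S) ((false ∷ S) ∷ map (false ∷_) L)

IsKTree : (k : ℕ) → ∀ {n} → Graph n → Set
IsKTree k {n} G = Σ (List (Subset n)) λ L → KTreeSeq k n G L

IsSimpleKTree : (k : ℕ) → ∀ {n} → Graph n → Set
IsSimpleKTree k {n} G = Σ (List (Subset n)) λ L → KTreeSeq k n G L × Unique L

HasTw≤ : ∀ {n} → Graph n → ℕ → Set
HasTw≤ G k = Σ ℕ λ m → Σ (Graph m) λ H → IsKTree k H × G ⊆G H

HasStw≤ : ∀ {n} → Graph n → ℕ → Set
HasStw≤ G k = Σ ℕ λ m → Σ (Graph m) λ H → IsSimpleKTree k H × G ⊆G H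

IsTw : ∀ {n} → Graph n → ℕ → Set
IsTw G = IsMin (HasTw≤ G)

IsStw : ∀ {n} → Graph n → ℕ → Set
IsStw G = IsMin (HasStw≤ G)

fiberSize : ∀ {m n} → (Fin m → Fin n) → Fin n → ℕ
fiberSize {m} φ v = sum (map (λ u → ind (does (φ u ≟ v))) (allFin m))

FoldedCover≤ : (∀ {m} → Graph m → Set) → ∀ {n} → Graph n → ℕ → Set
FoldedCover≤ 𝒯 {n} G c =
  Σ ℕ λ m → Σ (Graph m) λ T → 𝒯 T × Σ (Fin m → Fin n) λ φ →
    (∀ u v → Edge T u v → Edge G (φ u) (φ v)) ×
    (∀ x y → Edge G x y → Σ (Fin m) λ u → Σ (Fin m) λ v →
        Edge T u v × φ u ≡ x × φ v ≡ y) ×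
    (∀ x → fiberSize φ x ≤ c)

IsFoldedCoveringNumber : (∀ {m} → Graph m → Set) → ∀ {n} → Graph n → ℕ → Set
IsFoldedCoveringNumber 𝒯 G = IsMin (FoldedCover≤ 𝒯 G)

module _ {n : ℕ} (G : Graph n) where
  Cycle : Set
  Cycle = Σ (Fin n) λ x → Σ (List (Fin n)) λ xs →
    2 ≤ length xs × Unique (x ∷ xs) × Linked (Edge G) (x ∷ xs ++ [ x ])

  Forest : Set
  Forest = ¬ Cycle

  data Reach (x : Fin n) : Fin n → Set where
    here : Reach x x
    step : ∀ {y z} → Reach x y → Edge G y z → Reach x z

  NonLeaf : Fin n → Set
  NonLeaf v = 2 ≤ degree G v

  -- a forest each of whose components is a caterpillar: in the component of
  -- every vertex x, the non-leaf vertices are exactly the vertices of a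
  -- (possibly empty) path
  CaterpillarForest : Set
  CaterpillarForest = Forest × (∀ x → Σ (List (Fin n)) λ vs →
    Unique vs × Linked (Edge G) vs ×
    (∀ v → (v ∈L vs) ⇔ (Reach x v × NonLeaf v)))

  IntervalGraph : Set
  IntervalGraph = Σ (Fin n → ℚ) λ l → Σ (Fin n → ℚ) λ r →
    (∀ u → l u ≤ℚ r u) ×
    (∀ u v → u ≢ v → Edge G u v ⇔ (l u ≤ℚ r v × l v ≤ℚ r u))

IsCaf : ∀ {n} → Graph n → ℕ → Set
IsCaf = IsFoldedCoveringNumber CaterpillarForest

IsIntervalNumber : ∀ {n} → Graph n → ℕ → Set
IsIntervalNumber = IsFoldedCoveringNumber IntervalGraph

{-# OPTIONS --safe #-}
module Submission where

-- The graph is K_{k,n} with a pendant vertex attached to each of the n vertices on the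
-- right, where n = 2k² + 1; then tw = k and stw = ca_f = i = k + 1. We call the k vertices
-- on the left hubs and the n vertices on the right spokes.
--
-- Treewidth. A k-tree is k-degenerate, which gives tw ≥ k. In a simple k-tree the last
-- added spoke would be attached exactly to the hubs, so two earlier spokes
-- are common neighbours of a k-clique to which nothing was attached before; this is
-- impossible. The join of a k-clique with a path is a simple (k+1)-tree containing the graph.
--
-- Covering. In a caterpillar forest, and in a triangle-free interval graph, a vertex has
-- at most two non-leaf neighbours. If every vertex has at most k copies, then each spoke
-- has a copy serving two of its k + 1 edges, one of them to a hub copy; as there
-- are at most k² hub copies, some hub copy has three such neighbours. Conversely, orient
-- the edges with out-degree at most k and cover them by the stars of in-edges.

open import Defs
open import Data.Nat using (ℕ; suc; _≤_)
open import Data.Product using (Σ; _×_)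

open import Data.Bool using (Bool; true; false; if_then_else_)
open import Data.Bool.Properties using (¬-not)
open import Data.Empty using () renaming (⊥ to Empty)
open import Data.Fin using (Fin; zero; suc; _≟_; toℕ; splitAt; join; punchIn; lift; combine; remQuot)
open import Data.Fin.Properties
  using (suc-injective; toℕ-injective; toℕ<n; <⇒≢; injective⇒≤; pigeonhole; any?; lift-injective
        ; join-splitAt; punchInᵢ≢i; punchIn-injective
        ; combine-injective; combine-injectiveʳ; remQuot-combine; combine-remQuot)
open import Data.Fin.Subset using (Subset; _∈_; _∉_; _⊆_; ∣_∣; _-_; ⊤; ⊥)
open import Data.Fin.Subset.Properties
  using (⊆-antisym; ∈⊤; ∉⊥; ∣⊤∣≡n; p⊆q⇒∣p∣≤∣q∣; x∈p⇒∣p-x∣<∣p∣; x∈p∧x≢y⇒x∈p-y)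
import Data.Integer as ℤ
import Data.Integer.Properties as ℤ
open import Data.List using (List; []; _∷_; _++_; [_]; map; allFin; length)
import Data.List as List
open import Data.List.Membership.Propositional using () renaming (_∈_ to _∈L_)
open import Data.List.Membership.Propositional.Properties using (∈-map⁺)
import Data.List.Properties as List
open import Data.List.Relation.Unary.All as All using (All; []; _∷_)
import Data.List.Relation.Unary.All.Properties as All
open import Data.List.Relation.Unary.AllPairs using ([]; _∷_)
open import Data.List.Relation.Unary.Any using (here; there)
open import Data.List.Relation.Unary.Linked as Linked using (Linked; []; [-]; _∷_)
open import Data.List.Relation.Unary.Unique.Propositional using (Unique)
import Data.List.Relation.Unary.Unique.Propositional.Properties as Unique
open import Data.Nat using (zero; _+_; _*_; _<_; z≤n; s≤s; s≤s⁻¹)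
open import Data.Nat.Coprimality using (1-coprimeTo) renaming (sym to coprime-sym)
open import Data.Nat.ListAction using (sum)
open import Data.Nat.Properties
  using (≤-refl; ≤-reflexive; ≤-trans; ≤-antisym; ≤-<-trans; <-≤-trans; <⇒≤; <⇒≱; ≰⇒>; ≤∧≢⇒<; _≤?_
        ; n≤1+n; n<1+n; 1+n≰n; m≤m+n; m≤m*n; +-suc; +-comm; +-monoʳ-≤; +-monoʳ-<; +-cancelˡ-≤
        ; *-mono-≤; *-monoˡ-≤; module ≤-Reasoning)
open import Data.Product using (∃; _,_; proj₁; proj₂; uncurry)
open import Data.Rational using (ℚ; mkℚ; *≤*) renaming (_≤_ to _≤ℚ_; _≤?_ to _≤ℚ?_)
import Data.Rational.Properties as ℚ
open import Data.Sum using (_⊎_; inj₁; inj₂; swap; [_,_]′)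
open import Data.Vec using ([]; _∷_; tabulate; lookup; here; there)
open import Data.Vec.Properties
  using ([]=⇒lookup; lookup⇒[]=; lookup∘tabulate; lookup-replicate; ∷-injectiveʳ)
open import Function using (_∘_; id; const)
open import Function.Bundles using (mk⇔; module Equivalence)
open import Function.Definitions using (Injective)
open import Relation.Binary.PropositionalEquality
  using (_≡_; _≢_; refl; sym; trans; cong; cong₂; subst; subst₂)
open import Relation.Nullary using (¬_; Dec; yes; no; does; contradiction)
open import Relation.Nullary.Decidable using (¬?; _×-dec_; _⊎-dec_; does-⇔; dec-true; dec-false)

private
  variable
    k m n N : ℕ

-- Treewidth: lower bounds

enumerate : (S : Subset N) →
  Σ (Fin ∣ S ∣ → Fin N) λ e → Injective _≡_ _≡_ e × (∀ i → lookup S (e i) ≡ true)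
enumerate [] = (λ ()) , (λ { {()} }) , λ ()
enumerate (false ∷ S) with e , inj , e∈S ← enumerate S =
  suc ∘ e , inj ∘ suc-injective , e∈S
enumerate {suc N} (true ∷ S) with e , inj , e∈S ← enumerate S = e′ , inj′ , e′∈S
  where
  e′ : Fin (suc ∣ S ∣) → Fin (suc N)
  e′ zero    = zero
  e′ (suc i) = suc (e i)
  inj′ : Injective _≡_ _≡_ e′
  inj′ {zero}  {zero}  _  = refl
  inj′ {suc i} {suc j} eq = cong suc (inj (suc-injective eq))
  e′∈S : ∀ i → lookup (true ∷ S) (e′ i) ≡ true
  e′∈S zero    = refl
  e′∈S (suc i) = e∈S i

-- The bound `n` is left free so that sets of different sizes, such as the fibres of a cover, can be
-- numbered by one common set of labels.
rank : (S : Subset N) → ∣ S ∣ ≤ n →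
  Σ (∀ u → lookup S u ≡ true → Fin n) λ r →
    ∀ {u v} p q → r u p ≡ r v q → u ≡ v
rank [] _ = (λ ()) , λ { {()} }
rank (false ∷ S) ∣S∣≤n with r , inj ← rank S ∣S∣≤n =
  (λ { (suc u) p → r u p }) , λ { {suc u} {suc v} p q eq → cong suc (inj p q eq) }
rank {suc N} {suc n} (true ∷ S) (s≤s ∣S∣≤n) with r , inj ← rank S ∣S∣≤n = r′ , inj′
  where
  r′ : ∀ u → lookup (true ∷ S) u ≡ true → Fin (suc n)
  r′ zero    _ = zero
  r′ (suc u) p = suc (r u p)
  inj′ : ∀ {u v} p q → r′ u p ≡ r′ v q → u ≡ v
  inj′ {zero}  {zero}  _ _ _  = refl
  inj′ {suc u} {suc v} p q eq = cong suc (inj p q (suc-injective eq))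

injection-into⇒≤ : (S : Subset N) (f : Fin n → Fin N) → Injective _≡_ _≡_ f →
  (∀ i → lookup S (f i) ≡ true) → n ≤ ∣ S ∣
injection-into⇒≤ S f inj f∈S with r , r-inj ← rank S ≤-refl =
  injective⇒≤ {f = λ i → r (f i) (f∈S i)} (λ eq → inj (r-inj (f∈S _) (f∈S _) eq))

injective-on⇒∣∣≤ : (S : Subset N) (r : Fin N → Fin n) →
  (∀ {u v} → lookup S u ≡ true → lookup S v ≡ true → r u ≡ r v → u ≡ v) → ∣ S ∣ ≤ n
injective-on⇒∣∣≤ S r inj with e , e-inj , e∈S ← enumerate S =
  injective⇒≤ {f = r ∘ e} (λ eq → e-inj (inj (e∈S _) (e∈S _) eq))

-- A missed element of `S` would extend `f` to an injection of `suc n` elements into `S`.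
injection-onto : (S : Subset N) (f : Fin n → Fin N) → Injective _≡_ _≡_ f →
  (∀ i → lookup S (f i) ≡ true) → ∣ S ∣ ≤ n → ∀ {s} → lookup S s ≡ true → ∃ λ i → f i ≡ s
injection-onto {N} {n} S f inj f∈S ∣S∣≤n {s} s∈S with any? (λ i → f i ≟ s)
... | yes p = p
... | no ¬p = contradiction ∣S∣≤n (<⇒≱ (injection-into⇒≤ S f′ inj′ f′∈S))
  where
  f′ : Fin (suc n) → Fin N
  f′ zero    = s
  f′ (suc i) = f i
  inj′ : Injective _≡_ _≡_ f′
  inj′ {zero}  {zero}  _  = refl
  inj′ {zero}  {suc j} eq = contradiction (j , sym eq) ¬p
  inj′ {suc i} {zero}  eq = contradiction (i , eq) ¬p
  inj′ {suc i} {suc j} eq = cong suc (inj eq)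
  f′∈S : ∀ i → lookup S (f′ i) ≡ true
  f′∈S zero    = s∈S
  f′∈S (suc i) = f∈S i

⊆∧∣∣≤⇒≡ : {S T : Subset N} → S ⊆ T → ∣ T ∣ ≤ ∣ S ∣ → S ≡ T
⊆∧∣∣≤⇒≡ {S = S} {T} S⊆T ∣T∣≤∣S∣ with e , e-inj , e∈S ← enumerate S =
  ⊆-antisym S⊆T λ {t} t∈T →
    let i , eq = injection-onto T e e-inj (λ i → []=⇒lookup (S⊆T (lookup⇒[]= (e i) S (e∈S i)))) ∣T∣≤∣S∣ ([]=⇒lookup t∈T)
    in subst (_∈ S) eq (lookup⇒[]= (e i) S (e∈S i))

⊆∧2∉⇒2+∣∣≤ : {S T : Subset N} {b b′ : Fin N} → S ⊆ T → b ≢ b′ →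
  b ∈ T → b′ ∈ T → b ∉ S → b′ ∉ S → 2 + ∣ S ∣ ≤ ∣ T ∣
⊆∧2∉⇒2+∣∣≤ {S = S} {T} {b} {b′} S⊆T b≢b′ b∈T b′∈T b∉S b′∉S =
  <-≤-trans
    (s≤s (≤-<-trans
      (p⊆q⇒∣p∣≤∣q∣ {p = S} {T - b - b′} λ s∈S →
        x∈p∧x≢y⇒x∈p-y (x∈p∧x≢y⇒x∈p-y (S⊆T s∈S) (λ { refl → b∉S s∈S })) λ { refl → b′∉S s∈S })
      (x∈p⇒∣p-x∣<∣p∣ (x∈p∧x≢y⇒x∈p-y b′∈T (b≢b′ ∘ sym)))))
    (x∈p⇒∣p-x∣<∣p∣ b∈T)

-- Complete bipartite subgraphs of k-trees

Edge-sym : (G : Graph n) → ∀ u v → Edge G u v → Edge G v u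
Edge-sym G u v uv = trans (Graph.adj-sym G v u) uv

Edge⇒≢ : (G : Graph n) → ∀ {u v} → Edge G u v → u ≢ v
Edge⇒≢ G {u} uu refl with trans (sym (Graph.adj-irrefl G u)) uu
... | ()

-- A copy of K_{m,n} as a subgraph, not necessarily induced. That the two sides are disjoint follows
-- from the absence of loops.
record K⊆ (m n : ℕ) (H : Graph N) : Set where
  field
    α       : Fin m → Fin N
    β       : Fin n → Fin N
    α-inj   : Injective _≡_ _≡_ α
    β-inj   : Injective _≡_ _≡_ β
    αβ-edge : ∀ i j → Edge H (α i) (β j)

  α≢β : ∀ i j → α i ≢ β j
  α≢β i j = Edge⇒≢ H (αβ-edge i j)

K⊆-mono : {G : Graph n} {H : Graph N} → G ⊆G H → ∀ {m p} → K⊆ m p G → K⊆ m p H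
K⊆-mono (f , f-inj , f-hom) K = record
  { α = f ∘ α ; β = f ∘ β
  ; α-inj = α-inj ∘ f-inj _ _ ; β-inj = β-inj ∘ f-inj _ _
  ; αβ-edge = λ i j → f-hom _ _ (αβ-edge i j) }
  where open K⊆ K

-- The case distinction for inductions along a construction sequence: the vertex added last has
-- index `zero`, and a copy that avoids it already lies in `H`.
data Position {H : Graph N} {S : Subset N} (m n : ℕ) : K⊆ m n (extend H S) → Set where
  α-last : ∀ {K} i → K⊆.α K i ≡ zero → Position m n K
  β-last : ∀ {K} j → K⊆.β K j ≡ zero → Position m n K
  older  : ∀ {K} → K⊆ m n H → Position m n K

unsuc : (f : Fin n → Fin (suc N)) → (∀ i → f i ≢ zero) → Σ (Fin n → Fin N) λ g → ∀ i → f i ≡ suc (g i)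
unsuc {n} {N} f f≢0 = (λ i → proj₁ (pred i (f i) refl)) , λ i → proj₂ (pred i (f i) refl)
  where
  pred : (i : Fin n) (x : Fin (suc N)) → f i ≡ x → ∃ λ y → f i ≡ suc y
  pred i zero    eq = contradiction eq (f≢0 i)
  pred i (suc y) eq = y , eq

position : {H : Graph N} {S : Subset N} (K : K⊆ m n (extend H S)) → Position m n K
position {H = H} {S} K with any? (λ i → K⊆.α K i ≟ zero) | any? (λ j → K⊆.β K j ≟ zero)
... | yes (i , eq) | _            = α-last i eq
... | no _         | yes (j , eq) = β-last j eq
... | no ¬α        | no ¬β
  with α′ , α≡ ← unsuc (K⊆.α K) (λ i eq → ¬α (i , eq))
     | β′ , β≡ ← unsuc (K⊆.β K) (λ j eq → ¬β (j , eq)) = older (record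
  { α = α′ ; β = β′
  ; α-inj = λ {i} {j} eq → α-inj (trans (α≡ i) (trans (cong suc eq) (sym (α≡ j))))
  ; β-inj = λ {i} {j} eq → β-inj (trans (β≡ i) (trans (cong suc eq) (sym (β≡ j))))
  ; αβ-edge = λ i j → subst₂ (Edge (extend H S)) (α≡ i) (β≡ j) (αβ-edge i j) })
  where
  open K⊆ K

neighbours∈S : (H : Graph N) (S : Subset N) (f : Fin n → Fin (suc N)) → ∀ {x} → x ≡ zero →
  (∀ i → Edge (extend H S) x (f i)) →
  Σ (Fin n → Fin N) λ g → (∀ i → f i ≡ suc (g i)) × (∀ i → lookup S (g i) ≡ true)
neighbours∈S H S f refl edges
  with g , f≡ ← unsuc f (λ i eq → Edge⇒≢ (extend H S) (edges i) (sym eq)) =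
  g , f≡ , λ i → subst (Edge (extend H S) zero) (f≡ i) (edges i)

neighbours≤ : (H : Graph N) (S : Subset N) (f : Fin n → Fin (suc N)) → Injective _≡_ _≡_ f →
  ∀ {x} → x ≡ zero → (∀ i → Edge (extend H S) x (f i)) → n ≤ ∣ S ∣
neighbours≤ H S f inj x≡0 edges with g , f≡ , g∈S ← neighbours∈S H S f x≡0 edges =
  injection-into⇒≤ S g (λ {i} {j} eq → inj (trans (f≡ i) (trans (cong suc eq) (sym (f≡ j))))) g∈S

K⊆⇒≤ : {H : Graph N} → K⊆ m n H → m + n ≤ N
K⊆⇒≤ {N} {m} {n} K = injective⇒≤ {f = [ α , β ]′ ∘ splitAt m}
  (λ {i} {j} eq → trans (sym (join-splitAt m n i))
    (trans (cong (join m n) (inj (splitAt m i) (splitAt m j) eq)) (join-splitAt m n j)))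
  where
  open K⊆ K
  inj : ∀ x y → [ α , β ]′ x ≡ [ α , β ]′ y → x ≡ y
  inj (inj₁ i) (inj₁ j) eq = cong inj₁ (α-inj eq)
  inj (inj₁ i) (inj₂ j) eq = contradiction eq (α≢β i j)
  inj (inj₂ i) (inj₁ j) eq = contradiction (sym eq) (α≢β j i)
  inj (inj₂ i) (inj₂ j) eq = cong inj₂ (β-inj eq)

-- If the vertex added last belongs to the copy, it has at least `m` neighbours there, by `m ≤ n`,
-- while it has `k` in all; otherwise the copy is older. The base clique has only `suc k` vertices,
-- at least one of them on the side of `β`.
ktree-degenerate : ∀ {H : Graph N} {L} → KTreeSeq k N H L → m ≤ n → 1 ≤ n → K⊆ m n H → m ≤ k
ktree-degenerate {m = m} {suc n} base _ _ K =
  s≤s⁻¹ (≤-trans (≤-trans (s≤s (m≤m+n m n)) (≤-reflexive (sym (+-suc m n)))) (K⊆⇒≤ K))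
ktree-degenerate (add {G = H} seq S _ ∣S∣≡k) m≤n 1≤n K with position {H = H} K
... | α-last i eq = ≤-trans m≤n (subst (_ ≤_) ∣S∣≡k (neighbours≤ H S β β-inj eq (αβ-edge i)))
  where open K⊆ K
... | β-last j eq = subst (_ ≤_) ∣S∣≡k (neighbours≤ H S α α-inj eq (λ i → Edge-sym (extend H S) (α i) (β j) (αβ-edge i j)))
  where open K⊆ K
... | older K′ = ktree-degenerate seq m≤n 1≤n K′

-- Consider the vertex added last, onto `S′`. If it is `b` or `b′`, then `S` lies in `S′` and equals
-- it by size, so `S` is recorded in the list. If it belongs to `S`, then `b`, `b′` and the rest of
-- `S` all lie in `S′`, which is too small for `b` and `b′` to differ. In the remaining case the
-- claim is inherited.
common-neighbour-unique : ∀ {H : Graph N} {L} → KTreeSeq k N H L → (S : Subset N) → ∣ S ∣ ≡ k → IsClique H S →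
  ∀ {b b′} → b ∉ S → b′ ∉ S →
  (∀ {s} → s ∈ S → Edge H b s) → (∀ {s} → s ∈ S → Edge H b′ s) →
  S ∈L L ⊎ b ≡ b′
common-neighbour-unique {k = k} base S ∣S∣≡k _ {b} {b′} b∉S b′∉S _ _ with b ≟ b′
... | yes eq = inj₂ eq
... | no  ne = contradiction
  (subst₂ _≤_ (cong (2 +_) ∣S∣≡k) (∣⊤∣≡n (suc k))
    (⊆∧2∉⇒2+∣∣≤ {S = S} {⊤} (λ _ → ∈⊤) ne ∈⊤ ∈⊤ b∉S b′∉S))
  1+n≰n
common-neighbour-unique {k = k} (add {G = H} seq S′ _ ∣S′∣≡k) = added
  where
  S≡S′ : ∀ {S} → ∣ S ∣ ≡ k → (∀ {s} → suc s ∈ false ∷ S → lookup S′ s ≡ true) → S ≡ S′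
  S≡S′ ∣S∣≡k 0~S = ⊆∧∣∣≤⇒≡ (λ s∈S → lookup⇒[]= _ S′ (0~S (there s∈S)))
    (≤-reflexive (trans ∣S′∣≡k (sym ∣S∣≡k)))
  added : ∀ S → ∣ S ∣ ≡ k → IsClique (extend H S′) S → ∀ {b b′} → b ∉ S → b′ ∉ S →
    (∀ {s} → s ∈ S → Edge (extend H S′) b s) → (∀ {s} → s ∈ S → Edge (extend H S′) b′ s) →
    S ∈L _ ⊎ b ≡ b′
  added (false ∷ S) ∣S∣≡k K {zero} b∉S b′∉S b~S b′~S =
    inj₁ (here (cong (false ∷_) (S≡S′ ∣S∣≡k b~S)))
  added (false ∷ S) ∣S∣≡k K {suc b} {zero} b∉S b′∉S b~S b′~S =
    inj₁ (here (cong (false ∷_) (S≡S′ ∣S∣≡k b′~S)))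
  added (false ∷ S) ∣S∣≡k K {suc b} {suc b′} b∉S b′∉S b~S b′~S
    with common-neighbour-unique seq S ∣S∣≡k
           (λ u v u≢v u∈S v∈S → K (suc u) (suc v) (u≢v ∘ suc-injective) (there u∈S) (there v∈S))
           (b∉S ∘ there) (b′∉S ∘ there) (b~S ∘ there) (b′~S ∘ there)
  ... | inj₁ S∈L = inj₁ (there (∈-map⁺ (false ∷_) S∈L))
  ... | inj₂ eq  = inj₂ (cong suc eq)
  added (true ∷ S) ∣S∣≡k K {zero} b∉S = contradiction here b∉S
  added (true ∷ S) ∣S∣≡k K {suc b} {zero} b∉S b′∉S = contradiction here b′∉S
  added (true ∷ S) ∣S∣≡k K {suc b} {suc b′} b∉S b′∉S b~S b′~S with b ≟ b′
  ... | yes eq = inj₂ (cong suc eq)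
  ... | no  ne = contradiction
    (subst (2 + ∣ S ∣ ≤_) (trans ∣S′∣≡k (sym ∣S∣≡k))
      (⊆∧2∉⇒2+∣∣≤ {S = S} {S′} S⊆S′ ne (lookup⇒[]= b S′ (b~S here)) (lookup⇒[]= b′ S′ (b′~S here))
        (b∉S ∘ there) (b′∉S ∘ there)))
    1+n≰n
    where
    S⊆S′ : S ⊆ S′
    S⊆S′ {s} s∈S = lookup⇒[]= s S′ (K zero (suc s) (λ ()) here (there s∈S))

-- By `k < n` the last vertex cannot be some `α i`. If it is `β j`, its `k` neighbours `α i` fill
-- the clique `S`; by `3 ≤ n` there are two other vertices on the side of `β`, and they are common
-- neighbours of `S`, so `S` was used before.
K-not-in-simple-ktree : ∀ {H : Graph N} {L} → KTreeSeq k N H L → Unique L →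
  k < n → 3 ≤ n → ¬ K⊆ k n H
K-not-in-simple-ktree {k = k} {suc n} base _ _ (s≤s 2≤n) K =
  contradiction (+-cancelˡ-≤ k _ _ (≤-trans (K⊆⇒≤ K) (≤-reflexive (+-comm 1 k))))
    (<⇒≱ (s≤s (≤-trans (n≤1+n 1) 2≤n)))
K-not-in-simple-ktree {k = k} {n} (add {n = N} {G = H} seq S S-clique ∣S∣≡k) (S∉L ∷ L!) k<n (s≤s (s≤s (s≤s _))) K
  with position {H = H} K
... | older K′ = K-not-in-simple-ktree seq (Unique.map⁻ L!) k<n (s≤s (s≤s (s≤s z≤n))) K′
... | α-last i eq =
  contradiction (subst (_ ≤_) ∣S∣≡k (neighbours≤ H S β β-inj eq (αβ-edge i))) (<⇒≱ k<n)
  where open K⊆ K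
... | β-last j eq = contradiction′ (common-neighbour-unique seq S ∣S∣≡k S-clique (b∉S zero) (b∉S (suc zero)) (b~S zero) (b~S (suc zero)))
  where
  open K⊆ K
  nbrs : Σ (Fin k → Fin N) λ g → (∀ i → α i ≡ suc (g i)) × (∀ i → lookup S (g i) ≡ true)
  nbrs = neighbours∈S H S α eq (λ i → Edge-sym (extend H S) (α i) (β j) (αβ-edge i j))
  g = proj₁ nbrs
  α≡ = proj₁ (proj₂ nbrs)
  -- `punchIn j` runs through the indices other than `j`, so these vertices are older than `β j`.
  others : Σ (Fin _ → Fin N) λ b → ∀ i → β (punchIn j i) ≡ suc (b i)
  others = unsuc (β ∘ punchIn j) (λ i βi≡0 → punchInᵢ≢i j i (β-inj (trans βi≡0 (sym eq))))
  b = proj₁ others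
  β≡ = proj₂ others
  α-onto-S : ∀ {s} → s ∈ S → ∃ λ i → g i ≡ s
  α-onto-S s∈S = injection-onto S g
    (λ {i} {i′} gi≡gi′ → α-inj (trans (α≡ i) (trans (cong suc gi≡gi′) (sym (α≡ i′)))))
    (proj₂ (proj₂ nbrs)) (≤-reflexive ∣S∣≡k) ([]=⇒lookup s∈S)
  b∉S : ∀ i → b i ∉ S
  b∉S i bi∈S with i′ , gi′≡bi ← α-onto-S bi∈S =
    α≢β i′ (punchIn j i) (trans (α≡ i′) (trans (cong suc gi′≡bi) (sym (β≡ i))))
  b~S : ∀ i {s} → s ∈ S → Edge H (b i) s
  b~S i s∈S with i′ , refl ← α-onto-S s∈S =
    Edge-sym H (g i′) (b i) (subst₂ (Edge (extend H S)) (α≡ i′) (β≡ i) (αβ-edge i′ (punchIn j i)))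
  contradiction′ : S ∈L _ ⊎ b zero ≡ b (suc zero) → Empty
  contradiction′ (inj₁ S∈L) = Unique.Unique[x∷xs]⇒x∉xs (S∉L ∷ L!) (∈-map⁺ (false ∷_) S∈L)
  contradiction′ (inj₂ b0≡b1)
    with () ← punchIn-injective j zero (suc zero) (β-inj (trans (β≡ zero) (trans (cong suc b0≡b1) (sym (β≡ (suc zero))))))

-- The graph and the k-trees containing it

IsClique-⊆ : (G : Graph n) {S T : Subset n} → S ⊆ T → IsClique G T → IsClique G S
IsClique-⊆ G S⊆T K u v u≢v u∈S v∈S = K u v u≢v (S⊆T u∈S) (S⊆T v∈S)

IsClique-false∷ : {G : Graph n} {S T : Subset n} → IsClique G S → IsClique (extend G T) (false ∷ S)
IsClique-false∷ K (suc u) (suc v) u≢v (there u∈S) (there v∈S) = K u v (u≢v ∘ cong suc) u∈S v∈S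

IsClique-true∷ : {G : Graph n} {S T : Subset n} → S ⊆ T → IsClique G S → IsClique (extend G T) (true ∷ S)
IsClique-true∷ S⊆T K zero    zero    0≢0 _ _ = contradiction refl 0≢0
IsClique-true∷ S⊆T K zero    (suc v) _ _ (there v∈S) = []=⇒lookup (S⊆T v∈S)
IsClique-true∷ S⊆T K (suc u) zero    _ (there u∈S) _ = []=⇒lookup (S⊆T u∈S)
IsClique-true∷ S⊆T K (suc u) (suc v) u≢v (there u∈S) (there v∈S) = K u v (u≢v ∘ cong suc) u∈S v∈S

IsClique-complete : (S : Subset n) → IsClique (complete n) S
IsClique-complete S u v u≢v _ _ with u ≟ v
... | yes eq = contradiction eq u≢v
... | no  _  = refl

⊆G-extend : {G : Graph n} {H : Graph N} {S : Subset n} {T : Subset N} (G⊆H : G ⊆G H) →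
  (∀ {v} → v ∈ S → proj₁ G⊆H v ∈ T) → extend G S ⊆G extend H T
⊆G-extend {G = G} {H} {S} {T} (f , f-inj , f-hom) S→T =
  lift 1 f , (λ u v → lift-injective f (f-inj _ _) 1) , hom
  where
  mem : ∀ {v} → lookup S v ≡ true → lookup T (f v) ≡ true
  mem {v} v∈S = []=⇒lookup (S→T (lookup⇒[]= v S v∈S))
  hom : ∀ u v → Edge (extend G S) u v → Edge (extend H T) (lift 1 f u) (lift 1 f v)
  hom zero    (suc v) = mem
  hom (suc u) zero    = mem
  hom (suc u) (suc v) = f-hom u v

edgeless : ∀ n → Graph n
edgeless n = record { adj = λ _ _ → false ; adj-sym = λ _ _ → refl ; adj-irrefl = λ _ → refl }

edgeless-⊆G : (H : Graph N) (f : Fin n → Fin N) → Injective _≡_ _≡_ f → edgeless n ⊆G H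
edgeless-⊆G H f f-inj = f , (λ _ _ → f-inj) , λ _ _ ()

-- Each round adds a spoke and then its pendant vertex, so the latest pendant has index 0, its spoke
-- index 1, and all older indices shift by two.
order : ℕ → ℕ → ℕ
order k zero    = k
order k (suc j) = suc (suc (order k j))

hubs : ∀ k j → Subset (order k j)
hubs k zero    = ⊤
hubs k (suc j) = false ∷ false ∷ hubs k j

newest : ∀ n → Subset (suc n)
newest n = true ∷ ⊥

-- K_{k,j} with a pendant vertex attached to each of the j vertices on the right.
thorny : ∀ k j → Graph (order k j)
thorny k zero    = edgeless k
thorny k (suc j) = extend (extend (thorny k j) (hubs k j)) (newest _)

newest→true∷ : {f : Fin n → Fin N} {T : Subset N} → ∀ {v} → v ∈ newest n → lift 1 f v ∈ (true ∷ T)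
newest→true∷ {v = zero} _ = here
newest→true∷ {v = suc v} (there v∈⊥) = contradiction v∈⊥ ∉⊥

-- Over a base clique containing the hubs, each new pair is added onto the hubs and
-- onto the hubs with one of them replaced by the vertex just added.
record KTreeStage (k j : ℕ) : Set where
  field
    {size}   : ℕ
    {host}   : Graph size
    {steps}  : List (Subset size)
    seq      : KTreeSeq (suc k) size host steps
    A A⁻     : Subset size
    A⁻⊆A     : A⁻ ⊆ A
    ∣A∣      : ∣ A ∣ ≡ suc k
    ∣A⁻∣     : ∣ A⁻ ∣ ≡ k
    A-clique : IsClique host A
    embed    : thorny (suc k) j ⊆G host
    hubs→A   : ∀ {v} → v ∈ hubs (suc k) j → proj₁ embed v ∈ A

kTreeStage : ∀ k j → KTreeStage k j
kTreeStage k zero = record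
  -- Vertex 0 of the base clique is an extra vertex outside the embedded graph, and the others are
  -- the hubs. `A⁻` omits one hub, whose place the new spoke takes.
  { seq = base ; A = false ∷ ⊤ ; A⁻ = false ∷ false ∷ ⊤
  ; A⁻⊆A = λ { {suc _} _ → there ∈⊤ }
  ; ∣A∣ = ∣⊤∣≡n (suc k) ; ∣A⁻∣ = ∣⊤∣≡n k
  ; A-clique = IsClique-complete _
  ; embed = edgeless-⊆G (complete (suc (suc k))) suc suc-injective
  ; hubs→A = λ _ → there ∈⊤ }
kTreeStage k (suc j) = record
  { seq = add (add seq A A-clique ∣A∣) (true ∷ A⁻) (IsClique-true∷ A⁻⊆A (IsClique-⊆ host A⁻⊆A A-clique)) (cong suc ∣A⁻∣)
  ; A = false ∷ false ∷ A ; A⁻ = false ∷ false ∷ A⁻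
  ; A⁻⊆A = λ { (there (there v∈A⁻)) → there (there (A⁻⊆A v∈A⁻)) }
  ; ∣A∣ = ∣A∣ ; ∣A⁻∣ = ∣A⁻∣
  ; A-clique = IsClique-false∷ (IsClique-false∷ A-clique)
  ; embed = ⊆G-extend (⊆G-extend embed hubs→A) (newest→true∷ {f = proj₁ embed})
  ; hubs→A = λ { (there (there v∈)) → there (there (hubs→A v∈)) } }
  where open KTreeStage (kTreeStage k j)

thorny-tw≤ : ∀ k j → HasTw≤ (thorny (suc k) j) (suc k)
thorny-tw≤ k j = size , host , (steps , seq) , embed
  where open KTreeStage (kTreeStage k j)

-- The join of the hub clique A with a path. The newest vertex lies in every clique
-- used later but in none used before, so no clique is used twice.
record SimpleKTreeStage (k : ℕ) (G : Graph n) (hub : Subset n) : Set where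
  field
    {size}   : ℕ
    {host}   : Graph (suc size)
    {steps}  : List (Subset (suc size))
    seq      : KTreeSeq (suc k) (suc size) host steps
    steps!   : Unique steps
    newest∉  : All (λ S → lookup S zero ≡ false) steps
    A        : Subset size
    ∣A∣      : ∣ A ∣ ≡ k
    clique   : IsClique host (true ∷ A)
    embed    : G ⊆G host
    hub→A    : ∀ {v} → v ∈ hub → proj₁ embed v ∈ (false ∷ A)

-- The path is prolonged by one vertex, joined to `A` and to the former end of the path. This serves
-- a spoke, whose neighbours lie in `A`, as well as a pendant vertex, whose neighbour is the spoke
-- at that end.
addNewest : {G : Graph n} {hub : Subset n} (stage : SimpleKTreeStage k G hub) {S : Subset n} →
  (∀ {v} → v ∈ S → proj₁ (SimpleKTreeStage.embed stage) v ∈ (true ∷ SimpleKTreeStage.A stage)) →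
  SimpleKTreeStage k (extend G S) (false ∷ hub)
addNewest stage S→ = record
  { seq = add seq (true ∷ A) clique (cong suc ∣A∣)
  ; steps! = All.map⁺ (All.map (λ S₀≡false eq → fresh S₀≡false (∷-injectiveʳ eq)) newest∉)
             ∷ Unique.map⁺ ∷-injectiveʳ steps!
  ; newest∉ = refl ∷ All.map⁺ (All.map (λ _ → refl) newest∉)
  ; A = false ∷ A ; ∣A∣ = ∣A∣
  ; clique = IsClique-true∷ (λ { (there v∈A) → there v∈A }) (IsClique-⊆ host (λ { (there v∈A) → there v∈A }) clique)
  ; embed = ⊆G-extend embed S→
  ; hub→A = λ { (there v∈hub) → there (hub→A v∈hub) } }
  where
  open SimpleKTreeStage stage
  fresh : ∀ {S} → lookup S zero ≡ false → true ∷ A ≢ S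
  fresh () refl

simpleKTreeStage : ∀ k j → SimpleKTreeStage k (thorny k j) (hubs k j)
simpleKTreeStage k zero = record
  { seq = base ; steps! = [] ; newest∉ = []
  -- Vertices 0 and 1 of the base clique are the first two vertices of the path and represent no
  -- vertex of the graph.
  ; A = false ∷ ⊤ ; ∣A∣ = ∣⊤∣≡n k
  ; clique = IsClique-complete _
  ; embed = edgeless-⊆G (complete (suc (suc k))) (λ v → suc (suc v)) (suc-injective ∘ suc-injective)
  ; hub→A = λ _ → there (there ∈⊤) }
simpleKTreeStage k (suc j) =
  addNewest (addNewest stage (λ v∈hubs → false∷→true∷ (SimpleKTreeStage.hub→A stage v∈hubs)))
    (newest→true∷ {f = proj₁ (SimpleKTreeStage.embed stage)})
  where
  stage = simpleKTreeStage k j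
  false∷→true∷ : {S : Subset n} → (false ∷ S) ⊆ (true ∷ S)
  false∷→true∷ (there v∈S) = there v∈S

thorny-stw≤ : ∀ k j → HasStw≤ (thorny k j) (suc k)
thorny-stw≤ k j = _ , host , (steps , seq , steps!) , embed
  where open SimpleKTreeStage (simpleKTreeStage k j)

-- Hubs, spokes and pendants: 2-colouring and orientation

hub : ∀ k j → Fin k → Fin (order k j)
hub k zero    i = i
hub k (suc j) i = suc (suc (hub k j i))

spoke pendant : ∀ k j → Fin j → Fin (order k j)
spoke k (suc j) zero    = suc zero
spoke k (suc j) (suc i) = suc (suc (spoke k j i))
pendant k (suc j) zero    = zero
pendant k (suc j) (suc i) = suc (suc (pendant k j i))

hub∈hubs : ∀ k j i → lookup (hubs k j) (hub k j i) ≡ true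
hub∈hubs k zero    i = lookup-replicate i true
hub∈hubs k (suc j) i = hub∈hubs k j i

hubs⇒hub : ∀ k j v → lookup (hubs k j) v ≡ true → ∃ λ i → hub k j i ≡ v
hubs⇒hub k zero    v _ = v , refl
hubs⇒hub k (suc j) (suc (suc v)) v∈ with i , refl ← hubs⇒hub k j v v∈ = i , refl

hub-injective : ∀ k j → Injective _≡_ _≡_ (hub k j)
hub-injective k zero    eq = eq
hub-injective k (suc j) eq = hub-injective k j (suc-injective (suc-injective eq))

spoke-injective : ∀ k j → Injective _≡_ _≡_ (spoke k j)
spoke-injective k (suc j) {zero}  {zero}  _  = refl
spoke-injective k (suc j) {suc _} {suc _} eq = cong suc (spoke-injective k j (suc-injective (suc-injective eq)))

hub≢pendant : ∀ k j i l → hub k j i ≢ pendant k j l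
hub≢pendant k (suc j) i (suc l) eq = hub≢pendant k j i l (suc-injective (suc-injective eq))

hub-spoke : ∀ k j i l → Edge (thorny k j) (hub k j i) (spoke k j l)
hub-spoke k (suc j) i zero    = hub∈hubs k j i
hub-spoke k (suc j) i (suc l) = hub-spoke k j i l

spoke-pendant : ∀ k j l → Edge (thorny k j) (spoke k j l) (pendant k j l)
spoke-pendant k (suc j) zero    = refl
spoke-pendant k (suc j) (suc l) = spoke-pendant k j l

thorny-K⊆ : ∀ k j → K⊆ k j (thorny k j)
thorny-K⊆ k j = record
  { α = hub k j ; β = spoke k j
  ; α-inj = hub-injective k j ; β-inj = spoke-injective k j
  ; αβ-edge = hub-spoke k j }

newest⇒zero : ∀ n v → lookup (newest n) v ≡ true → v ≡ zero
newest⇒zero n zero    _ = refl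
newest⇒zero n (suc v) v∈⊥ = contradiction (lookup⇒[]= v ⊥ v∈⊥) ∉⊥

thorny-bipartite : ∀ k j → Bipartite (thorny k j)
thorny-bipartite k j = color j , proper j
  where
  color : ∀ j → Fin (order k j) → Bool
  color zero    _             = true
  color (suc j) zero          = true
  color (suc j) (suc zero)    = false
  color (suc j) (suc (suc v)) = color j v
  hubs-color : ∀ j v → lookup (hubs k j) v ≡ true → color j v ≡ true
  hubs-color zero    _             _  = refl
  hubs-color (suc j) (suc (suc v)) v∈ = hubs-color j v v∈
  hubs-color-≢ : ∀ j v → lookup (hubs k j) v ≡ true → false ≢ color j v
  hubs-color-≢ j v v∈ eq with () ← trans eq (hubs-color j v v∈)
  proper : ∀ j u v → Edge (thorny k j) u v → color j u ≢ color j v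
  proper (suc j) zero (suc v) uv eq with newest⇒zero _ v uv
  ... | refl with () ← eq
  proper (suc j) (suc u) zero uv eq with newest⇒zero _ u uv
  ... | refl with () ← eq
  proper (suc j) (suc zero)    (suc (suc v)) uv = hubs-color-≢ j v uv
  proper (suc j) (suc (suc u)) (suc zero)    uv = hubs-color-≢ j u uv ∘ sym
  proper (suc j) (suc (suc u)) (suc (suc v)) uv = proper j u v uv

-- Values out u i that are not neighbours of u are to be ignored.
Oriented : ℕ → Graph n → Set
Oriented {n} k G = Σ (Fin n → Fin k → Fin n) λ out →
  ∀ u v → Edge G u v → ∃ λ i → out u i ≡ v ⊎ out v i ≡ u

-- A pendant points to its spoke and a spoke to the `suc k` hubs. A hub has no out-neighbour, so its
-- values are the hub itself.
thorny-oriented : ∀ k j → Oriented (suc k) (thorny (suc k) j)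
thorny-oriented k j = out j , directed j
  where
  out : ∀ j → Fin (order (suc k) j) → Fin (suc k) → Fin (order (suc k) j)
  out zero    v             _ = v
  out (suc j) zero          _ = suc zero
  out (suc j) (suc zero)    i = suc (suc (hub (suc k) j i))
  out (suc j) (suc (suc v)) i = suc (suc (out j v i))
  directed : ∀ j u v → Edge (thorny (suc k) j) u v → ∃ λ i → out j u i ≡ v ⊎ out j v i ≡ u
  directed (suc j) zero (suc v) uv with newest⇒zero _ v uv
  ... | refl = zero , inj₁ refl
  directed (suc j) (suc u) zero uv with newest⇒zero _ u uv
  ... | refl = zero , inj₂ refl
  directed (suc j) (suc zero) (suc (suc v)) uv with i , refl ← hubs⇒hub (suc k) j v uv = i , inj₁ refl
  directed (suc j) (suc (suc u)) (suc zero) uv with i , refl ← hubs⇒hub (suc k) j u uv = i , inj₂ refl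
  directed (suc j) (suc (suc u)) (suc (suc v)) uv with directed j u v uv
  ... | i , inj₁ eq = i , inj₁ (cong (λ v → suc (suc v)) eq)
  ... | i , inj₂ eq = i , inj₂ (cong (λ v → suc (suc v)) eq)

-- Covering by stars

decided : ∀ {P : Set} (P? : Dec P) → does P? ≡ true → P
decided (yes p) _ = p

-- Turns degrees and fibre sizes into sizes of subsets, to which the counting lemmas apply.
sum-ind≡∣tabulate∣ : (f : Fin n → Bool) → sum (map (λ u → ind (f u)) (allFin n)) ≡ ∣ tabulate f ∣
sum-ind≡∣tabulate∣ f = trans (cong sum (List.map-tabulate id (ind ∘ f))) (go f)
  where
  go : (f : Fin n → Bool) → sum (List.tabulate (ind ∘ f)) ≡ ∣ tabulate f ∣
  go {zero}  f = refl
  go {suc n} f with f zero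
  ... | true  = cong suc (go (f ∘ suc))
  ... | false = go (f ∘ suc)

degree≤ : (G : Graph n) (v : Fin n) (r : Fin n → Fin k) →
  (∀ {x y} → Edge G v x → Edge G v y → r x ≡ r y → x ≡ y) → degree G v ≤ k
degree≤ G v r inj = ≤-trans (≤-reflexive (sum-ind≡∣tabulate∣ (Graph.adj G v)))
  (injective-on⇒∣∣≤ (tabulate (Graph.adj G v)) r λ {x} {y} vx vy →
    inj (trans (sym (lookup∘tabulate (Graph.adj G v) x)) vx) (trans (sym (lookup∘tabulate (Graph.adj G v) y)) vy))

fiber : (Fin m → Fin n) → Fin n → Subset m
fiber φ v = tabulate (λ u → does (φ u ≟ v))

∈fiber⁺ : (φ : Fin m → Fin n) → ∀ {u v} → φ u ≡ v → lookup (fiber φ v) u ≡ true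
∈fiber⁺ φ {u} {v} eq = trans (lookup∘tabulate (λ u → does (φ u ≟ v)) u) (dec-true (φ u ≟ v) eq)

∈fiber⁻ : (φ : Fin m → Fin n) → ∀ {u v} → lookup (fiber φ v) u ≡ true → φ u ≡ v
∈fiber⁻ φ {u} {v} u∈ = decided (φ u ≟ v) (trans (sym (lookup∘tabulate (λ u → does (φ u ≟ v)) u)) u∈)

fiberSize≡ : (φ : Fin m → Fin n) → ∀ v → fiberSize φ v ≡ ∣ fiber φ v ∣
fiberSize≡ φ v = sum-ind≡∣tabulate∣ (λ u → does (φ u ≟ v))

fiberSize≤ : (φ : Fin m → Fin n) (r : Fin m → Fin k) →
  (∀ {u v} → φ u ≡ φ v → r u ≡ r v → u ≡ v) → ∀ x → fiberSize φ x ≤ k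
fiberSize≤ φ r inj x = ≤-trans (≤-reflexive (fiberSize≡ φ x))
  (injective-on⇒∣∣≤ (fiber φ x) r λ u∈ v∈ → inj (trans (∈fiber⁻ φ u∈) (sym (∈fiber⁻ φ v∈))))

fiber-numbering : (φ : Fin m → Fin n) → (∀ x → fiberSize φ x ≤ k) →
  Σ (Fin m → Fin k) λ r → ∀ {u v} → φ u ≡ φ v → r u ≡ r v → u ≡ v
fiber-numbering {m} {n} {k} φ size≤ = (λ u → proj₁ (ranks (φ u)) u (∈fiber⁺ φ refl)) , inj
  where
  ranks : ∀ x → Σ (∀ u → lookup (fiber φ x) u ≡ true → Fin k) λ r → ∀ {u v} p q → r u p ≡ r v q → u ≡ v
  ranks x = rank (fiber φ x) (≤-trans (≤-reflexive (sym (fiberSize≡ φ x))) (size≤ x))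
  inj′ : ∀ {x y u v} (x≡y : x ≡ y) p q → proj₁ (ranks x) u p ≡ proj₁ (ranks y) v q → u ≡ v
  inj′ {x} refl = proj₂ (ranks x)
  inj : ∀ {u v} → φ u ≡ φ v → _ → u ≡ v
  inj eq = inj′ eq (∈fiber⁺ φ refl) (∈fiber⁺ φ refl)

-- Star forests as caterpillar forests and as interval graphs

fromℕ : ℕ → ℚ
fromℕ n = mkℚ (ℤ.+ n) 0 (coprime-sym (1-coprimeTo n))

fromℕ-mono : ∀ {a b} → a ≤ b → fromℕ a ≤ℚ fromℕ b
fromℕ-mono a≤b = *≤* (subst₂ ℤ._≤_ (sym (ℤ.*-identityʳ _)) (sym (ℤ.*-identityʳ _)) (ℤ.+≤+ a≤b))

fromℕ-cancel : ∀ {a b} → fromℕ a ≤ℚ fromℕ b → a ≤ b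
fromℕ-cancel (*≤* a≤b) = ℤ.drop‿+≤+ (subst₂ ℤ._≤_ (ℤ.*-identityʳ _) (ℤ.*-identityʳ _) a≤b)

-- Both sides are read in base `suc m`: since the last digit `b` is at most `m`, a larger leading
-- digit decides the comparison.
*-+-cancel-≤ : ∀ {m x y a b} → b ≤ m → x * suc m + a ≤ y * suc m + b → x ≤ y
*-+-cancel-≤ {m} {x} {y} {a} {b} b≤m le with x ≤? y
... | yes x≤y = x≤y
... | no  x≰y = contradiction le (<⇒≱ (begin-strict
  y * suc m + b     <⟨ +-monoʳ-< (y * suc m) (s≤s b≤m) ⟩
  y * suc m + suc m ≡⟨ +-comm (y * suc m) (suc m) ⟩
  suc y * suc m     ≤⟨ *-monoˡ-≤ (suc m) (≰⇒> x≰y) ⟩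
  x * suc m         ≤⟨ m≤m+n (x * suc m) a ⟩
  x * suc m + a     ∎))
  where open ≤-Reasoning

-- A star forest is encoded by the idempotent map sending each vertex to the center of its star; the
-- centers are the fixed points.
module StarForest {m} (c : Fin m → Fin m) (c-idem : ∀ u → c (c u) ≡ c u) where

  adj? : ∀ u v → Dec (u ≢ v × (c u ≡ v ⊎ c v ≡ u))
  adj? u v = ¬? (u ≟ v) ×-dec ((c u ≟ v) ⊎-dec (c v ≟ u))

  stars : Graph m
  stars = record
    { adj        = λ u v → does (adj? u v)
    ; adj-sym    = λ u v → does-⇔ (mk⇔ flip flip) (adj? u v) (adj? v u)
    ; adj-irrefl = λ u → dec-false (adj? u u) (λ { (u≢u , _) → u≢u refl }) }
    where
    flip : ∀ {u v} → u ≢ v × (c u ≡ v ⊎ c v ≡ u) → v ≢ u × (c v ≡ u ⊎ c u ≡ v)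
    flip (u≢v , eq) = u≢v ∘ sym , swap eq

  edge⁻ : ∀ {u v} → Edge stars u v → u ≢ v × (c u ≡ v ⊎ c v ≡ u)
  edge⁻ {u} {v} = decided (adj? u v)

  edge⁺ : ∀ {u v} → u ≢ v → c u ≡ v ⊎ c v ≡ u → Edge stars u v
  edge⁺ {u} {v} u≢v eq = dec-true (adj? u v) (u≢v , eq)

  same-center : ∀ {u v} → Edge stars u v → c u ≡ c v
  same-center uv with edge⁻ uv
  ... | _ , inj₁ refl = sym (c-idem _)
  ... | _ , inj₂ refl = c-idem _

  leaf-neighbour : ∀ {u v} → Edge stars u v → c u ≢ u → c u ≡ v
  leaf-neighbour uv cu≢u with edge⁻ uv
  ... | _ , inj₁ eq   = eq
  ... | _ , inj₂ refl = contradiction (c-idem _) cu≢u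

  closing-edge : ∀ {x} z ws → Linked (Edge stars) (z ∷ ws ++ [ x ]) → ∃ λ w → w ∈L (z ∷ ws) × Edge stars w x
  closing-edge z []       (zx ∷ [-]) = z , here refl , zx
  closing-edge z (w ∷ ws) (_ ∷ rest) with v , v∈ , vx ← closing-edge w ws rest = v , there v∈ , vx

  -- A leaf has its center as only neighbour. If `x` is a leaf, its two neighbours on the cycle
  -- coincide. If `x` is a center, then `y` is either a center of the same star, hence `x`, or a
  -- leaf, and then its neighbours `x` and `z` coincide.
  stars-forest : Forest stars
  stars-forest (x , y ∷ []     , s≤s () , _)
  stars-forest (x , y ∷ z ∷ ws , _ , ((x≢y ∷ x≢z ∷ _) ∷ y∉ ∷ _) , xy ∷ yz ∷ rest) with c x ≟ x | c y ≟ y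
  ... | no  cx≢x | _ with w , w∈ , wx ← closing-edge z ws rest =
    All.lookup y∉ w∈ (trans (sym (leaf-neighbour xy cx≢x)) (leaf-neighbour (Edge-sym stars w x wx) cx≢x))
  ... | yes cx≡x | yes cy≡y = x≢y (trans (sym cx≡x) (trans (same-center xy) cy≡y))
  ... | yes _    | no  cy≢y = x≢z (trans (sym (leaf-neighbour (Edge-sym stars x y xy) cy≢y)) (leaf-neighbour yz cy≢y))

  reach⇒same-center : ∀ {x v} → Reach stars x v → c x ≡ c v
  reach⇒same-center here        = refl
  reach⇒same-center (step p yz) = trans (reach⇒same-center p) (same-center yz)

  reach-center : ∀ x → Reach stars x (c x)
  reach-center x with x ≟ c x
  ... | yes eq = subst (Reach stars x) eq here
  ... | no  ne = step here (edge⁺ ne (inj₁ refl))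

  nonLeaf⇒center : ∀ {v} → NonLeaf stars v → c v ≡ v
  nonLeaf⇒center {v} 2≤deg with c v ≟ v
  ... | yes eq = eq
  ... | no  ne = contradiction
    (degree≤ {k = 1} stars v (const zero) λ vx vy _ → trans (sym (leaf-neighbour vx ne)) (leaf-neighbour vy ne))
    (<⇒≱ 2≤deg)

  -- Only a center can be a non-leaf, so the spine of a component is its center, or empty if the
  -- center has degree below 2.
  stars-caterpillar : CaterpillarForest stars
  stars-caterpillar = stars-forest , spine
    where
    spine : ∀ x → _
    spine x with 2 ≤? degree stars (c x)
    ... | yes 2≤deg = [ c x ] , [] ∷ [] , [-] , λ v → mk⇔
      (λ { (here refl) → reach-center x , 2≤deg })
      (λ { (x↝v , v-nonLeaf) → here (trans (sym (nonLeaf⇒center v-nonLeaf)) (sym (reach⇒same-center x↝v))) })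
    ... | no  2≰deg = [] , [] , [] , λ v → mk⇔ (λ ())
      (λ { (x↝v , v-nonLeaf) → contradiction
        (subst (NonLeaf stars) (trans (sym (nonLeaf⇒center v-nonLeaf)) (sym (reach⇒same-center x↝v))) v-nonLeaf) 2≰deg })

  -- The star with center x lives in the block [x (m + 1) , x (m + 1) + m]; its center
  -- occupies the whole block and its leaves are distinct points of the block.
  lo hi : Fin m → ℕ
  lo u = if does (c u ≟ u) then 0 else toℕ u
  hi u = if does (c u ≟ u) then m else toℕ u

  lo≤hi : ∀ u → lo u ≤ hi u
  lo≤hi u with c u ≟ u
  ... | yes _ = z≤n
  ... | no  _ = ≤-refl

  hi≤m : ∀ u → hi u ≤ m
  hi≤m u with c u ≟ u
  ... | yes _ = ≤-refl
  ... | no  _ = <⇒≤ (toℕ<n u)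

  lo-center : ∀ u → c u ≡ u → lo u ≡ 0
  lo-center u eq with c u ≟ u
  ... | yes _ = refl
  ... | no ne = contradiction eq ne

  hi-center : ∀ u → c u ≡ u → hi u ≡ m
  hi-center u eq with c u ≟ u
  ... | yes _ = refl
  ... | no ne = contradiction eq ne

  lo-leaf : ∀ u → c u ≢ u → lo u ≡ toℕ u
  lo-leaf u ne with c u ≟ u
  ... | yes eq = contradiction eq ne
  ... | no  _  = refl

  hi-leaf : ∀ u → c u ≢ u → hi u ≡ toℕ u
  hi-leaf u ne with c u ≟ u
  ... | yes eq = contradiction eq ne
  ... | no  _  = refl

  left right : Fin m → ℕ
  left  u = toℕ (c u) * suc m + lo u
  right u = toℕ (c u) * suc m + hi u

  -- Overlapping intervals lie in one block, and there two leaves are points that meet only if they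
  -- are equal.
  overlap⇒edge : ∀ {u v} → u ≢ v → left u ≤ right v → left v ≤ right u → Edge stars u v
  overlap⇒edge {u} {v} u≢v lu≤rv lv≤ru = by-cases (c u ≟ u) (c v ≟ v)
    where
    cu≡cv : c u ≡ c v
    cu≡cv = toℕ-injective (≤-antisym (*-+-cancel-≤ (hi≤m v) lu≤rv) (*-+-cancel-≤ (hi≤m u) lv≤ru))
    leaves-≤ : ∀ {u v} → c u ≢ u → c v ≢ v → c u ≡ c v → left u ≤ right v → toℕ u ≤ toℕ v
    leaves-≤ {u} {v} cu≢u cv≢v cu≡cv lu≤rv = +-cancelˡ-≤ (toℕ (c v) * suc m) _ _
      (subst₂ _≤_ (cong₂ (λ x a → toℕ x * suc m + a) cu≡cv (lo-leaf u cu≢u))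
        (cong (toℕ (c v) * suc m +_) (hi-leaf v cv≢v)) lu≤rv)
    by-cases : Dec (c u ≡ u) → Dec (c v ≡ v) → Edge stars u v
    by-cases (yes cu≡u) _          = edge⁺ u≢v (inj₂ (trans (sym cu≡cv) cu≡u))
    by-cases (no  _)    (yes cv≡v) = edge⁺ u≢v (inj₁ (trans cu≡cv cv≡v))
    by-cases (no  cu≢u) (no  cv≢v) = contradiction (toℕ-injective (≤-antisym
      (leaves-≤ cu≢u cv≢v cu≡cv lu≤rv) (leaves-≤ cv≢v cu≢u (sym cu≡cv) lv≤ru))) u≢v

  left-center : ∀ v → c v ≡ v → left v ≡ toℕ v * suc m + 0
  left-center v eq = cong₂ (λ x a → toℕ x * suc m + a) eq (lo-center v eq)

  right-center : ∀ v → c v ≡ v → right v ≡ toℕ v * suc m + m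
  right-center v eq = cong₂ (λ x a → toℕ x * suc m + a) eq (hi-center v eq)

  center-overlaps : ∀ {u v} → c u ≡ v → left u ≤ right v × left v ≤ right u
  center-overlaps {u} refl =
    subst (left u ≤_) (sym (right-center (c u) (c-idem u)))
      (+-monoʳ-≤ (toℕ (c u) * suc m) (≤-trans (lo≤hi u) (hi≤m u))) ,
    subst (_≤ right u) (sym (left-center (c u) (c-idem u)))
      (+-monoʳ-≤ (toℕ (c u) * suc m) z≤n)

  edge⇒overlap : ∀ {u v} → Edge stars u v → left u ≤ right v × left v ≤ right u
  edge⇒overlap {u} {v} uv with edge⁻ uv
  ... | _ , inj₁ eq = center-overlaps eq
  ... | _ , inj₂ eq with p , q ← center-overlaps eq = q , p

  stars-interval : IntervalGraph stars
  stars-interval = fromℕ ∘ left , fromℕ ∘ right ,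
    (λ u → fromℕ-mono (+-monoʳ-≤ (toℕ (c u) * suc m) (lo≤hi u))) ,
    λ u v u≢v → mk⇔
      (λ uv → fromℕ-mono (proj₁ (edge⇒overlap uv)) , fromℕ-mono (proj₂ (edge⇒overlap uv)))
      (λ { (p , q) → overlap⇒edge u≢v (fromℕ-cancel p) (fromℕ-cancel q) })

-- Vertex v is split into the center (v , 0) of a star and, for each i, a leaf
-- (v , 1 + i) of the star with center (out v i , 0).
module StarCover {N k} (G : Graph N) (oriented : Oriented k G) where

  out : Fin N → Fin k → Fin N
  out = proj₁ oriented

  center′ : Fin N × Fin (suc k) → Fin N × Fin (suc k)
  center′ (v , zero)  = v , zero
  -- A copy whose value of `out` is not a neighbour of `v` becomes its own center and stays
  -- isolated.
  center′ (v , suc i) = if Graph.adj G v (out v i) then (out v i , zero) else (v , suc i)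

  center′-idem : ∀ p → center′ (center′ p) ≡ center′ p
  center′-idem (v , zero) = refl
  center′-idem (v , suc i) with Graph.adj G v (out v i) in eq
  ... | true = refl
  ... | false rewrite eq = refl

  center′-edge : ∀ p → center′ p ≢ p → Edge G (proj₁ p) (proj₁ (center′ p))
  center′-edge (v , zero)  ne = contradiction refl ne
  center′-edge (v , suc i) ne with Graph.adj G v (out v i) in eq
  ... | true  = eq
  ... | false = contradiction refl ne

  split : Fin (N * suc k) → Fin N × Fin (suc k)
  split = remQuot {N} (suc k)

  center : Fin (N * suc k) → Fin (N * suc k)
  center = uncurry combine ∘ center′ ∘ split

  split-center : ∀ w → split (center w) ≡ center′ (split w)
  split-center w = remQuot-combine _ _

  center-idem : ∀ w → center (center w) ≡ center w
  center-idem w = cong (uncurry combine) (trans (cong center′ (split-center w)) (center′-idem (split w)))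

  φ : Fin (N * suc k) → Fin N
  φ = proj₁ ∘ split

  open StarForest center center-idem

  center-edge : ∀ w → center w ≢ w → Edge G (φ w) (φ (center w))
  center-edge w ne = subst (Edge G (φ w)) (sym (cong proj₁ (split-center w)))
    (center′-edge (split w) λ eq → ne (trans (cong (uncurry combine) eq) (combine-remQuot {N} (suc k) w)))

  φ-hom : ∀ u v → Edge stars u v → Edge G (φ u) (φ v)
  φ-hom u v uv with edge⁻ uv
  ... | u≢v , inj₁ refl = center-edge u (u≢v ∘ sym)
  ... | u≢v , inj₂ refl = Edge-sym G (φ v) (φ u) (center-edge v u≢v)

  Lifted : Fin N → Fin N → Set
  Lifted x y = Σ _ λ u → Σ _ λ v → Edge stars u v × φ u ≡ x × φ v ≡ y

  out-lifted : ∀ x i → Edge G x (out x i) → Lifted x (out x i)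
  out-lifted x i xy = leaf′ , hub′ ,
    edge⁺ (λ eq → zero≢suc (sym (combine-injectiveʳ x (suc i) (out x i) zero eq))) (inj₁ center-leaf′) ,
    cong proj₁ (remQuot-combine x (suc i)) , cong proj₁ (remQuot-combine (out x i) (zero {k}))
    where
    leaf′ = combine x (suc i)
    hub′  = combine (out x i) (zero {k})
    zero≢suc : zero ≢ suc i
    zero≢suc ()
    center-leaf′ : center leaf′ ≡ hub′
    center-leaf′ rewrite remQuot-combine x (suc i) | xy = refl

  φ-surj : ∀ x y → Edge G x y → Lifted x y
  φ-surj x y xy with proj₂ oriented x y xy
  ... | i , inj₁ refl = out-lifted x i xy
  ... | i , inj₂ refl with u , v , uv , φu , φv ← out-lifted y i (Edge-sym G x y xy) =
    v , u , Edge-sym stars u v uv , φv , φu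

  star-cover : (𝒯 : ∀ {m} → Graph m → Set) → 𝒯 stars → FoldedCover≤ 𝒯 G (suc k)
  star-cover 𝒯 stars∈𝒯 = _ , stars , stars∈𝒯 , φ , φ-hom , φ-surj ,
    fiberSize≤ φ (proj₂ ∘ split) (λ {u} {v} eq₁ eq₂ →
      trans (sym (combine-remQuot {N} (suc k) u))
        (trans (cong₂ combine eq₁ eq₂) (combine-remQuot {N} (suc k) v)))

oriented⇒caf≤ : (G : Graph N) → Oriented k G → FoldedCover≤ CaterpillarForest G (suc k)
oriented⇒caf≤ G oriented = star-cover CaterpillarForest stars-caterpillar
  where
  open StarCover G oriented
  open StarForest center center-idem

oriented⇒interval≤ : (G : Graph N) → Oriented k G → FoldedCover≤ IntervalGraph G (suc k)
oriented⇒interval≤ G oriented = star-cover IntervalGraph stars-interval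
  where
  open StarCover G oriented
  open StarForest center center-idem

-- Lower bound for covers

-- A vertex has at most two non-leaf neighbours, told apart by the side they lie on.
TwoSided : Graph n → Set
TwoSided {n} T = Σ (Fin n → Fin n → Bool) λ side →
  ∀ {x y y′ w w′} → Edge T x y → Edge T y w → w ≢ x → Edge T x y′ → Edge T y′ w′ → w′ ≢ x →
  side x y ≡ side x y′ → y ≡ y′

-- If w is adjacent to y but not to x, then the interval of y contains an endpoint of
-- that of x; two neighbours of x containing the same endpoint are adjacent.
interval⇒twoSided : (T : Graph n) → Bipartite T → IntervalGraph T → TwoSided T
interval⇒twoSided T (color , proper) (l , r , l≤r , edge⇔) = (λ x y → does (l y ≤ℚ? l x)) , same-side
  where
  meet : ∀ {u v} → Edge T u v → l u ≤ℚ r v × l v ≤ℚ r u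
  meet {u} {v} uv = Equivalence.to (edge⇔ u v (Edge⇒≢ T uv)) uv
  no-triangle : ∀ {x y z} → Edge T x y → Edge T x z → ¬ Edge T y z
  no-triangle {x} {y} {z} xy xz yz = proper y z yz
    (trans (¬-not (proper y x (Edge-sym T x y xy))) (sym (¬-not (proper z x (Edge-sym T x z xz)))))
  disjoint⇒≡ : ∀ {x y z} → Edge T x y → Edge T x z → l y ≤ℚ r z → l z ≤ℚ r y → y ≡ z
  disjoint⇒≡ {x} {y} {z} xy xz p q with y ≟ z
  ... | yes eq = eq
  ... | no  ne = contradiction (Equivalence.from (edge⇔ y z ne) (p , q)) (no-triangle xy xz)
  -- Here `y` starts after `x` does. Either `w` starts beyond `r x`, and `y` reaches that far to
  -- meet it, or `w` meets `x` and closes a triangle.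
  right-end : ∀ {x y w} → Edge T x y → Edge T y w → w ≢ x → ¬ (l y ≤ℚ l x) → r x ≤ℚ r y
  right-end {x} {y} {w} xy yw w≢x ly≰lx with l w ≤ℚ? r x
  ... | no  lw≰rx = ℚ.≤-trans (ℚ.<⇒≤ (ℚ.≰⇒> lw≰rx)) (proj₂ (meet yw))
  ... | yes lw≤rx = contradiction
    (Equivalence.from (edge⇔ x w (w≢x ∘ sym))
      (ℚ.≤-trans (ℚ.<⇒≤ (ℚ.≰⇒> ly≰lx)) (proj₁ (meet yw)) , lw≤rx))
    (no-triangle (Edge-sym T x y xy) yw)
  same-side : ∀ {x y y′ w w′} → Edge T x y → Edge T y w → w ≢ x → Edge T x y′ → Edge T y′ w′ → w′ ≢ x →
    does (l y ≤ℚ? l x) ≡ does (l y′ ≤ℚ? l x) → y ≡ y′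
  same-side {x} {y} {y′} xy yw w≢x xy′ y′w′ w′≢x = by-cases (l y ≤ℚ? l x) (l y′ ≤ℚ? l x)
    where
    by-cases : (p : Dec (l y ≤ℚ l x)) (p′ : Dec (l y′ ≤ℚ l x)) → does p ≡ does p′ → y ≡ y′
    by-cases (yes p) (yes p′) _ = disjoint⇒≡ xy xy′
      (ℚ.≤-trans p (proj₁ (meet xy′))) (ℚ.≤-trans p′ (proj₁ (meet xy)))
    by-cases (no ¬p) (no ¬p′) _ = disjoint⇒≡ xy xy′
      (ℚ.≤-trans (proj₂ (meet xy)) (right-end xy′ y′w′ w′≢x ¬p′))
      (ℚ.≤-trans (proj₂ (meet xy′)) (right-end xy yw w≢x ¬p))

-- Caterpillar forests: neighbours along a path

module _ {A : Set} where

  upTo : ∀ {y : A} {zs} → y ∈L zs → List A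
  upTo (here {x = z} _)  = [ z ]
  upTo (there {x = z} p) = z ∷ upTo p

  All-upTo : ∀ {P : A → Set} {y zs} (p : y ∈L zs) → All P zs → All P (upTo p)
  All-upTo (here _)  (pz ∷ _)   = pz ∷ []
  All-upTo (there p) (pz ∷ pzs) = pz ∷ All-upTo p pzs

  Unique-upTo : ∀ {y zs} (p : y ∈L zs) → Unique zs → Unique (upTo p)
  Unique-upTo (here _)  _          = [] ∷ []
  Unique-upTo (there p) (z∉ ∷ zs!) = All-upTo p z∉ ∷ Unique-upTo p zs!

  Linked-upTo : ∀ {R : A → A → Set} {x y t zs} (p : y ∈L zs) → Linked R (x ∷ zs) → R y t →
    Linked R (x ∷ upTo p ++ [ t ])
  Linked-upTo (here refl) (xz ∷ _)  yt = xz ∷ yt ∷ [-]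
  Linked-upTo (there p)   (xz ∷ zs) yt = xz ∷ Linked-upTo p zs yt

-- If `y` came after `z`, the edge from `y` back to `x` would close the path up to `y` into a cycle
-- of length at least 3.
forest-no-chord : (T : Graph n) → Forest T → ∀ {x y z zs} → Unique (x ∷ z ∷ zs) →
  Linked (Edge T) (x ∷ z ∷ zs) → Edge T x y → y ∈L (z ∷ zs) → y ≡ z
forest-no-chord T forest _ _ _ (here eq) = eq
forest-no-chord T forest {x} {y} {z} (x∉ ∷ z!) walk xy (there p) = contradiction
  (x , upTo (there {x = z} p) , 2≤ p , (All-upTo (there p) x∉ ∷ Unique-upTo (there p) z!) ,
    Linked-upTo (there p) walk (Edge-sym T x y xy))
  forest
  where
  2≤ : ∀ {zs} (p : y ∈L zs) → 2 ≤ length (upTo (there {x = z} p))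
  2≤ (here _)  = s≤s (s≤s z≤n)
  2≤ (there _) = s≤s (s≤s z≤n)

2≤degree : (T : Graph n) → ∀ {x y y′} → Edge T x y → Edge T x y′ → y ≢ y′ → 2 ≤ degree T x
2≤degree T {x} {y} {y′} xy xy′ y≢y′ = subst (2 ≤_) (sym (sum-ind≡∣tabulate∣ (Graph.adj T x)))
  (injection-into⇒≤ (tabulate (Graph.adj T x)) f f-inj f-adj)
  where
  f : Fin 2 → Fin _
  f zero    = y
  f (suc _) = y′
  f-inj : Injective _≡_ _≡_ f
  f-inj {zero}     {zero}     _  = refl
  f-inj {zero}     {suc zero} eq = contradiction eq y≢y′
  f-inj {suc zero} {zero}     eq = contradiction (sym eq) y≢y′
  f-inj {suc zero} {suc zero} _  = refl
  f-adj : ∀ i → lookup (tabulate (Graph.adj T x)) (f i) ≡ true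
  f-adj zero    = trans (lookup∘tabulate (Graph.adj T x) y) xy
  f-adj (suc _) = trans (lookup∘tabulate (Graph.adj T x) y′) xy′

-- Records on which side of `x` the vertex `y` lies along a path.
before : Fin n → Fin n → List (Fin n) → Bool
before x y [] = false
before x y (z ∷ zs) with z ≟ y | z ≟ x
... | yes _ | _     = true
... | no _  | yes _ = false
... | no _  | no _  = before x y zs

in-tail : ∀ {A : Set} {x z : A} {zs} → z ≢ x → x ∈L (z ∷ zs) → x ∈L zs
in-tail z≢x (here x≡z) = contradiction (sym x≡z) z≢x
in-tail z≢x (there x∈) = x∈

-- Without chords `x` comes directly after `y`, so nothing in `zs` precedes it.
neighbour-first : (T : Graph n) → Forest T → ∀ {x y y′ zs} → Unique (y ∷ zs) → Linked (Edge T) (y ∷ zs) →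
  x ∈L zs → Edge T x y → x ≢ y′ → before x y′ zs ≡ false
neighbour-first T forest {x} {y} {y′} {z ∷ zs} zs! walk x∈ xy x≢y′
  with refl ← forest-no-chord T forest zs! walk (Edge-sym T x y xy) x∈
  with x ≟ y′ | x ≟ x
... | yes x≡y′ | _      = contradiction x≡y′ x≢y′
... | no _     | yes _  = refl
... | no _     | no x≢x = contradiction refl x≢x

-- Follow the path to the first of `x`, `y` and `y′`. If only `y` is met there, `x` comes next and
-- `y′` lies beyond it, so the sides differ; likewise for `y′`. If `x` is met, both neighbours are
-- its successor.
path-neighbours : (T : Graph n) → Forest T → ∀ {x y y′} zs → Unique zs → Linked (Edge T) zs →
  x ∈L zs → y ∈L zs → y′ ∈L zs → Edge T x y → Edge T x y′ →
  before x y zs ≡ before x y′ zs → y ≡ y′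
path-neighbours T forest {x} {y} {y′} (z ∷ zs) zs!@(_ ∷ tail!) walk x∈ y∈ y′∈ xy xy′ eq
  with z ≟ y | z ≟ y′ | z ≟ x
... | yes refl | yes refl | _        = refl
... | yes refl | no  _    | yes refl = contradiction refl (Edge⇒≢ T xy)
... | yes refl | no  _    | no  z≢x
  with () ← trans eq (neighbour-first T forest zs! walk (in-tail z≢x x∈) xy (Edge⇒≢ T xy′))
... | no  _    | yes refl | yes refl = contradiction refl (Edge⇒≢ T xy′)
... | no  _    | yes refl | no  z≢x
  with () ← trans (sym eq) (neighbour-first T forest zs! walk (in-tail z≢x x∈) xy′ (Edge⇒≢ T xy))
... | no  z≢y  | no  z≢y′ | no  z≢x  =
  path-neighbours T forest zs tail! (Linked.tail walk)
    (in-tail z≢x x∈) (in-tail z≢y y∈) (in-tail z≢y′ y′∈) xy xy′ eq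
... | no  z≢y  | no  z≢y′ | yes refl with in-tail z≢y y∈ | in-tail z≢y′ y′∈
path-neighbours T forest (z ∷ u ∷ us) zs! walk _ _ _ xy xy′ _ | no _ | no _ | yes refl | y∈ | y′∈ =
  trans (forest-no-chord T forest zs! walk xy y∈) (sym (forest-no-chord T forest zs! walk xy′ y′∈))

-- If `y` and `y′` differ, then `x` has degree at least 2, and so do `y` and `y′` by `w` and `w′`.
-- All three therefore lie on the spine of the component of `x`.
caterpillar⇒twoSided : (T : Graph n) → CaterpillarForest T → TwoSided T
caterpillar⇒twoSided T (forest , spine) = side , same-side
  where
  side : Fin _ → Fin _ → Bool
  side x y = before x y (proj₁ (spine x))
  same-side : ∀ {x y y′ w w′} → Edge T x y → Edge T y w → w ≢ x → Edge T x y′ → Edge T y′ w′ → w′ ≢ x →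
    side x y ≡ side x y′ → y ≡ y′
  same-side {x} {y} {y′} xy yw w≢x xy′ y′w′ w′≢x eq with y ≟ y′
  ... | yes y≡y′ = y≡y′
  ... | no  y≢y′ =
    let vs , vs! , walk , spine⇔ = spine x in
    path-neighbours T forest vs vs! walk
      (Equivalence.from (spine⇔ x) (here , 2≤degree T xy xy′ y≢y′))
      (Equivalence.from (spine⇔ y) (step here xy , 2≤degree T yw (Edge-sym T x y xy) w≢x))
      (Equivalence.from (spine⇔ y′) (step here xy′ , 2≤degree T y′w′ (Edge-sym T x y′ xy′) w′≢x))
      xy xy′ eq

-- Counting spokes by copies of hubs

module CoverBound {k} (G : Graph N) (α : Fin k → Fin N) (β π : Fin n → Fin N)
  (α-inj : Injective _≡_ _≡_ α) (β-inj : Injective _≡_ _≡_ β) (α≢π : ∀ i j → α i ≢ π j)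
  (αβ : ∀ i j → Edge G (α i) (β j)) (βπ : ∀ j → Edge G (β j) (π j)) where

  target : Fin n → Fin (suc k) → Fin N
  target j zero    = π j
  target j (suc i) = α i

  target-injective : ∀ j → Injective _≡_ _≡_ (target j)
  target-injective j {zero}  {zero}  _  = refl
  target-injective j {zero}  {suc _} eq = contradiction (sym eq) (α≢π _ j)
  target-injective j {suc _} {zero}  eq = contradiction eq (α≢π _ j)
  target-injective j {suc _} {suc _} eq = cong suc (α-inj eq)

  β-target : ∀ j i → Edge G (β j) (target j i)
  β-target j zero    = βπ j
  β-target j (suc i) = Edge-sym G (α i) (β j) (αβ i j)

  module _ {M} (T : Graph M) (φ : Fin M → Fin N)
    (φ-surj : ∀ x y → Edge G x y → Σ (Fin M) λ u → Σ (Fin M) λ v → Edge T u v × φ u ≡ x × φ v ≡ y)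
    (fiber≤k : ∀ x → fiberSize φ x ≤ k) where

    number : Fin M → Fin k
    number = proj₁ (fiber-numbering φ fiber≤k)

    number-injective : ∀ {u v} → φ u ≡ φ v → number u ≡ number v → u ≡ v
    number-injective = proj₂ (fiber-numbering φ fiber≤k)

    -- A copy y of β j that serves two of the k + 1 edges from β j to π j and the α i.
    record Spine (j : Fin n) : Set where
      field
        i     : Fin k
        x y w : Fin M
        φx    : φ x ≡ α i
        φy    : φ y ≡ β j
        xy    : Edge T x y
        yw    : Edge T y w
        w≢x   : w ≢ x

    spine : ∀ j → Spine j
    spine j with pigeonhole (n<1+n k) (λ i → number (proj₁ (φ-surj _ _ (β-target j i))))
    -- Two of the `suc k` edges at `β j` share a copy of `β j`. The larger of the two indices is a
    -- successor, so its target is the hub `α i′` and not the pendant vertex.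
    ... | i , suc i′ , i<i′ , eq
      with y , w , yw , φy , φw ← φ-surj _ _ (β-target j i)
         | y′ , x , y′x , φy′ , φx ← φ-surj _ _ (β-target j (suc i′))
      with refl ← number-injective (trans φy (sym φy′)) eq = record
      { i = i′ ; x = x ; y = y ; w = w ; φx = φx ; φy = φy
      ; xy = Edge-sym T y x y′x ; yw = yw
      ; w≢x = λ { refl → <⇒≢ i<i′ (target-injective j (trans (sym φw) φx)) } }

    fromBool : Bool → Fin 2
    fromBool false = zero
    fromBool true  = suc zero

    fromBool-injective : Injective _≡_ _≡_ fromBool
    fromBool-injective {false} {false} _ = refl
    fromBool-injective {true}  {true}  _ = refl

    -- A copy of a hub is given by the hub and its number, which makes `k * k` choices. Together
    -- with the side on which `y j` lies it determines `y j`, and hence `j`.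
    twoSided⇒few : TwoSided T → n ≤ k * k * 2
    twoSided⇒few (side , same-side) = injective⇒≤ code-injective
      where
      open module S j = Spine (spine j)
      code : Fin n → Fin (k * k * 2)
      code j = combine (combine (i j) (number (x j))) (fromBool (side (x j) (y j)))
      code-injective : Injective _≡_ _≡_ code
      code-injective {j} {j′} eq
        with eq₁ , side≡ ← combine-injective (combine (i j) (number (x j))) (fromBool (side (x j) (y j)))
               (combine (i j′) (number (x j′))) (fromBool (side (x j′) (y j′))) eq
        with i≡ , number≡ ← combine-injective (i j) (number (x j)) (i j′) (number (x j′)) eq₁ =
        β-inj (trans (sym (φy j)) (trans (cong φ y≡) (φy j′)))
        where
        x≡ : x j ≡ x j′
        x≡ = number-injective (trans (φx j) (trans (cong α i≡) (sym (φx j′)))) number≡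
        y≡ : y j ≡ y j′
        y≡ = same-side {x j′} (subst (λ u → Edge T u (y j)) x≡ (xy j)) (yw j) (λ w≡ → w≢x j (trans w≡ (sym x≡)))
               (xy j′) (yw j′) (w≢x j′)
               (trans (cong (λ u → side u (y j)) (sym x≡)) (fromBool-injective side≡))

  -- The hypothesis on `𝒯` provides the homomorphism `φ` because interval graphs obtain the
  -- 2-colouring that excludes triangles by pulling back that of `G`.
  cover-bound : (𝒯 : ∀ {m} → Graph m → Set) →
    (∀ {m} (T : Graph m) (φ : Fin m → Fin N) → (∀ u v → Edge T u v → Edge G (φ u) (φ v)) → 𝒯 T → TwoSided T) →
    k * k * 2 < n → ∀ c → FoldedCover≤ 𝒯 G c → suc k ≤ c
  cover-bound 𝒯 two-sided large c (_ , T , T∈𝒯 , φ , φ-hom , φ-surj , fiber≤c) with c ≤? k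
  ... | no  c≰k = ≰⇒> c≰k
  ... | yes c≤k = contradiction
    (twoSided⇒few T φ φ-surj (λ x → ≤-trans (fiber≤c x) c≤k) (two-sided T φ φ-hom T∈𝒯)) (<⇒≱ large)

k<k*k*2+1 : ∀ k → suc k < suc (suc k * suc k * 2)
k<k*k*2+1 k = s≤s (≤-trans (m≤m*n (suc k) (suc k)) (m≤m*n (suc k * suc k) 2))

3≤k*k*2+1 : ∀ k → 3 ≤ suc (suc k * suc k * 2)
3≤k*k*2+1 k = s≤s (*-mono-≤ {1} {suc k * suc k} {2} (s≤s z≤n) ≤-refl)

theorem15 : (k : ℕ) → 1 ≤ k →
    Σ ℕ λ n → Σ (Graph n) λ G → Bipartite G ×
    Σ ℕ λ t → Σ ℕ λ s → Σ ℕ λ c →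
    IsTw G t × IsStw G s × IsCaf G c × IsIntervalNumber G c ×
    s ≤ suc t × suc t ≤ suc k × suc k ≤ c
theorem15 (suc k) (s≤s _) =
  _ , G , bipartite , suc k , suc (suc k) , suc (suc k) ,
  (thorny-tw≤ k j , tw≥) ,
  (thorny-stw≤ (suc k) j , stw≥) ,
  (oriented⇒caf≤ G (thorny-oriented k j) ,
    cover-bound CaterpillarForest (λ T _ _ → caterpillar⇒twoSided T) ≤-refl) ,
  (oriented⇒interval≤ G (thorny-oriented k j) ,
    cover-bound IntervalGraph (λ T φ φ-hom → interval⇒twoSided T
      (proj₁ bipartite ∘ φ , λ u v uv → proj₂ bipartite (φ u) (φ v) (φ-hom u v uv))) ≤-refl) ,
  ≤-refl , ≤-refl , ≤-refl
  where
  -- One spoke more than the number of codes in `twoSided⇒few`.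
  j = suc (suc k * suc k * 2)
  G = thorny (suc k) j
  bipartite = thorny-bipartite (suc k) j
  open CoverBound G (hub (suc k) j) (spoke (suc k) j) (pendant (suc k) j)
    (hub-injective (suc k) j) (spoke-injective (suc k) j) (hub≢pendant (suc k) j)
    (hub-spoke (suc k) j) (spoke-pendant (suc k) j)
  tw≥ : ∀ m → HasTw≤ G m → suc k ≤ m
  tw≥ m (_ , H , (_ , seq) , G⊆H) =
    ktree-degenerate seq (≤-trans (n≤1+n _) (k<k*k*2+1 k)) (s≤s z≤n) (K⊆-mono G⊆H (thorny-K⊆ (suc k) j))
  stw≥ : ∀ m → HasStw≤ G m → suc (suc k) ≤ m
  -- A simple k-tree is a k-tree, so `tw≥` applies and only `m = suc k` remains to be excluded.
  stw≥ m (_ , H , (L , seq , L!) , G⊆H) = ≤∧≢⇒< (tw≥ m (_ , H , (L , seq) , G⊆H))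
    λ { refl → K-not-in-simple-ktree seq L! (k<k*k*2+1 k) (3≤k*k*2+1 k) (K⊆-mono G⊆H (thorny-K⊆ (suc k) j)) }
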